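{- There is an absolute constant $C>0$ such that the following holds. For any $\varepsilon>0$ there is a $\delta=\delta(\varepsilon)\ge 2^{ -C/\varepsilon}$ (i.e. $\delta=2^{ -O(1/\varepsilon)}$) such that for every bipartite graph $G$ with bipartition $X\cup Y$, $|X|=n$ and $|Y|=2n$, if $\mathrm{im}(G)<(1-\varepsilon)n$, then $\log\mathrm{irr}(G)<(1-\delta)n$.
   Context: $\log=\log_2$. An induced matching of $G$ is an induced subgraph that is a matching; $\mathrm{im}(G)$ is the number of edges in a largest induced matching. A set $X'\subseteq X$ is irredundant if for every $x\in X'$, $N(x)\not\subseteq N(X'\setminus\{x\})$ (with $N(S)=\bigcup_{x\in S}N(x)$); $\mathrm{irr}(G)$ is the number of irredundant subsets of $X$. -}

module Defs where

open import Data.Nat using (ℕ; zero; suc; _+_; _*_)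
open import Data.Bool using (Bool; true; false; _∧_; _∨_; not; if_then_else_)
open import Data.Fin using (Fin; _≟_)
open import Data.Fin.Properties using ()
open import Data.List using (List; []; _∷_; map; _++_; length; filter; allFin)
open import Data.Bool.ListAction using (all; any)
open import Data.Vec using (Vec; []; _∷_; lookup)
open import Data.Product using (Σ; _×_; _,_) public
open import Function.Definitions using (Injective)
open import Function.Bundles using (_⇔_)
open import Relation.Binary.PropositionalEquality using (_≡_)
open import Relation.Nullary.Decidable using (⌊_⌋)

BipGraph : ℕ → ℕ → Set
BipGraph n m = Fin n → Fin m → Bool

-- An induced matching with k edges: edges (f i , g i), i : Fin k,
-- with distinct endpoints, such that f i is adjacent to g j iff i ≡ j
-- (so the subgraph induced on {f i} ∪ {g i} is exactly the matching).
InducedMatching : ∀ {n m} → BipGraph n m → ℕ → Set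
InducedMatching {n} {m} G k =
  Σ (Fin k → Fin n) λ f → Σ (Fin k → Fin m) λ g →
    Injective _≡_ _≡_ f × Injective _≡_ _≡_ g ×
    (∀ i j → (G (f i) (g j) ≡ true) ⇔ (i ≡ j))

subsets : (n : ℕ) → List (Vec Bool n)
subsets zero = [] ∷ []
subsets (suc n) = map (false ∷_) (subsets n) ++ map (true ∷_) (subsets n)

irredundant : ∀ {n m} → BipGraph n m → Vec Bool n → Bool
irredundant {n} {m} G S =
  all (λ x → not (lookup S x) ∨
        any (λ y → G x y ∧
              all (λ x' → not (lookup S x') ∨ ⌊ x' ≟ x ⌋ ∨ not (G x' y))
                  (allFin n))
            (allFin m))
      (allFin n)

irr : ∀ {n m} → BipGraph n m → ℕ
irr {n} G = length (filter (λ S → irredundant G S ≡? true) (subsets n))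
  where
  open import Data.Bool using () renaming (_≟_ to _≡?_)

{-# OPTIONS --safe #-}

-- An irredundant set together with one private neighbour per element is an induced matching.
-- Keep a set X of undecided vertices and a list Ys of still usable vertices of Y. While X is larger
-- than every induced matching, some x in X has no private neighbour in Ys relative to X. If x has
-- at least 3k neighbours in Ys, branch on x: taking x makes all of them useless to the other
-- vertices, which can happen only a few times since |Y| = 2n. Otherwise x and one further element
-- of X at each neighbour of x form a set of at most 3k vertices contained in no irredundant set, so
-- at least one of its traces is lost. With r < 1 close to 1, the potential 2^|X| r^(k|X| - s - |Ys|)
-- dominates the number of irredundant sets through both kinds of step.
module Submission where

open import Defs
open import Algebra.Properties.CommutativeSemigroup using (interchange)
open import Data.Bool using (Bool; true; false; not; _∧_; _∨_; if_then_else_)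
  renaming (T to True; _≟_ to _≟ᵇ_)
open import Data.Bool.ListAction using (all)
open import Data.Bool.Properties using (T-≡; T-∧)
open import Data.Empty using (⊥-elim)
open import Data.Fin using (Fin; zero; suc; _≟_)
import Data.Fin.Properties as Fin
open import Data.Fin.Subset
open import Data.Fin.Subset.Properties
open import Data.List using (List; []; _∷_; map; _++_; length; filter; allFin)
open import Data.List.Membership.Propositional.Properties using (∈-allFin)
open import Data.List.Properties using (filter-++; length-++; length-tabulate)
open import Data.List.Relation.Unary.All as All using (All; []; _∷_)
open import Data.List.Relation.Unary.All.Properties using (all⁺; ¬Any⇒All¬)
open import Data.List.Relation.Unary.Any as Any using (Any; here; there)
open import Data.List.Relation.Unary.Any.Properties using (any⁻)
open import Data.Nat using (ℕ; zero; suc; _+_; _*_; _∸_; _^_; _<_; _≤_; _≤?_; _<?_; z≤n; s≤s; s≤s⁻¹;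
  >-nonZero)
open import Data.Nat.DivMod using (_/_; m≡m%n+[m/n]*n; m/n*n≤m; m%n<n)
open import Data.Nat.Properties hiding (_≟_; ≡-irrelevant)
open import Data.Nat.Tactic.RingSolver using (solve-∀)
open import Data.Product using (∃; proj₁; proj₂)
open import Data.Sum using ([_,_]′)
open import Data.Vec using ([]; _∷_; lookup; here; there)
open import Data.Vec.Properties using ([]=⇒lookup; map-replicate)
open import Function using (_∘_; Injective; Equivalence; mk⇔)
open import Relation.Binary.PropositionalEquality
open import Relation.Nullary using (Dec; yes; no; does; ¬_; ¬?; contradiction)
open import Relation.Nullary.Decidable using (⌊_⌋; _×-dec_; _→-dec_)
open import Relation.Unary using (Decidable)

-- Powers and Bernoulli inequalities in natural numbers.

+-interchange = interchange +-commutativeSemigroup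
*-interchange = interchange *-commutativeSemigroup

m*n+m*n≡2*m*n : ∀ m n → m * n + m * n ≡ 2 * m * n
m*n+m*n≡2*m*n = solve-∀

n≤2^n : ∀ n → n ≤ 2 ^ n
n≤2^n zero    = z≤n
n≤2^n (suc n) = ≤-trans (+-mono-≤ (m^n>0 2 n) (n≤2^n n))
  (≤-reflexive (cong (2 ^ n +_) (sym (+-identityʳ (2 ^ n)))))

-- Absorbs linear factors such as 4T and 12T into powers 2^(O(T)), the shape of all the constants
-- chosen at the end.
*≤2^ : ∀ {c} i T → c ≤ 2 ^ i → c * suc T ≤ 2 ^ (suc i * suc T)
*≤2^ {c} i T c≤ = begin
  c * suc T                       ≤⟨ *-mono-≤ c≤ (n≤2^n (suc T)) ⟩
  2 ^ i * 2 ^ suc T               ≡⟨ ^-distribˡ-+-* 2 i (suc T) ⟨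
  2 ^ (i + suc T)                 ≤⟨ ^-monoʳ-≤ 2 exponents ⟩
  2 ^ (suc i * suc T)             ∎
  where
  open ≤-Reasoning
  exponents : i + suc T ≤ suc i * suc T
  exponents = ≤-trans (+-monoˡ-≤ (suc T) (m≤m*n i (suc T))) (≤-reflexive (+-comm (i * suc T) (suc T)))

^-distribʳ-* : ∀ o m n → (m * n) ^ o ≡ m ^ o * n ^ o
^-distribʳ-* zero    m n = refl
^-distribʳ-* (suc o) m n =
  trans (cong (m * n *_) (^-distribʳ-* o m n)) (*-interchange m n (m ^ o) (n ^ o))

^-swap : ∀ b i j → (b ^ i) ^ j ≡ (b ^ j) ^ i
^-swap b i j = trans (^-*-assoc b i j) (trans (cong (b ^_) (*-comm i j)) (sym (^-*-assoc b j i)))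

-- Bernoulli's inequality (1 - 1/(a+1))^j ≥ 1 - j/(a+1) with denominators cleared.
bernoulli-below : ∀ a j → suc a ^ j * suc a ≤ a ^ j * suc a + j * suc a ^ j
bernoulli-below a zero = ≤-reflexive (sym (+-identityʳ _))
bernoulli-below a (suc j) = begin
  suc a * p * suc a                 ≡⟨ *-assoc (suc a) p (suc a) ⟩
  p * suc a + a * (p * suc a)       ≤⟨ +-monoʳ-≤ _ (*-monoʳ-≤ a (bernoulli-below a j)) ⟩
  p * suc a + a * (q * suc a + j * p) ≤⟨ m≤m+n _ (j * p) ⟩
  p * suc a + a * (q * suc a + j * p) + j * p ≡⟨ shuffle a j p q ⟩
  a * q * suc a + suc j * (suc a * p) ∎
  where
  open ≤-Reasoning
  p = suc a ^ j
  q = a ^ j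
  shuffle : ∀ a j p q → p * suc a + a * (q * suc a + j * p) + j * p ≡ a * q * suc a + suc j * (suc a * p)
  shuffle = solve-∀

-- The companion inequality (1 + 1/a)^j ≥ 1 + j/a, again without division.
bernoulli-above : ∀ a j → a ^ j * (a + j) ≤ suc a ^ j * a
bernoulli-above a zero = ≤-reflexive (cong (λ z → z + 0) (+-identityʳ a))
bernoulli-above a (suc j) = begin
  a * p * (a + suc j)             ≡⟨ e₁ a p j ⟩
  a * (p * (a + j)) + a * p       ≤⟨ +-monoʳ-≤ _ (*-monoˡ-≤ p (m≤m+n a j)) ⟩
  a * (p * (a + j)) + (a + j) * p ≡⟨ e₂ a p j ⟩
  suc a * (p * (a + j))           ≤⟨ *-monoʳ-≤ (suc a) (bernoulli-above a j) ⟩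
  suc a * (suc a ^ j * a)         ≡⟨ *-assoc (suc a) (suc a ^ j) a ⟨
  suc a * suc a ^ j * a           ∎
  where
  open ≤-Reasoning
  p = a ^ j
  e₁ : ∀ a p j → a * p * (a + suc j) ≡ a * (p * (a + j)) + a * p
  e₁ = solve-∀
  e₂ : ∀ a p j → a * (p * (a + j)) + (a + j) * p ≡ suc a * (p * (a + j))
  e₂ = solve-∀

-- With r = a/(a+1), Bernoulli gives r^j ≥ 1 - j/(a+1) ≥ 1 - 1/(β+1). A lost fraction 1/(β+1) of the
-- sets can thus be charged as j factors r.
power-ratio : ∀ a j β → suc β * j ≤ suc a → β * suc a ^ j ≤ suc β * a ^ j
power-ratio a j β h = *-cancelʳ-≤ (β * p) (suc β * q) (suc a)
  (+-cancelʳ-≤ (suc a * p) _ _ (begin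
    β * p * suc a + suc a * p       ≡⟨ e₁ a β p ⟩
    suc β * (p * suc a)             ≤⟨ *-monoʳ-≤ (suc β) (bernoulli-below a j) ⟩
    suc β * (q * suc a + j * p)     ≡⟨ e₂ a β j p q ⟩
    suc β * q * suc a + suc β * j * p ≤⟨ +-monoʳ-≤ _ (*-monoˡ-≤ p h) ⟩
    suc β * q * suc a + suc a * p   ∎))
  where
  open ≤-Reasoning
  p = suc a ^ j
  q = a ^ j
  e₁ : ∀ a β p → β * p * suc a + suc a * p ≡ suc β * (p * suc a)
  e₁ = solve-∀
  e₂ : ∀ a β j p q → suc β * (q * suc a + j * p) ≡ suc β * q * suc a + suc β * j * p
  e₂ = solve-∀

-- With r = p/q this is 1 + r³ ≤ 2r, which holds for (√5 - 1)/2 ≤ r ≤ 1.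
cubic-bound : ∀ p q → p ≤ q → 2 * q ≤ 3 * p → q * q * q + p * p * p ≤ 2 * (p * (q * q))
cubic-bound p q p≤q 2q≤3p with m≤n⇒∃[o]m+o≡n p≤q
... | t , refl with m≤n⇒∃[o]m+o≡n (+-cancelˡ-≤ (2 * p) (2 * t) p
                      (subst₂ _≤_ (*-distribˡ-+ 2 p t) (+-comm p (2 * p)) 2q≤3p))
-- After the substitution p = 2t + u, q = p + t, the difference of the two sides is a polynomial
-- with nonnegative coefficients.
...   | u , refl = ≤-trans (m≤m+n _ (t * t * t + 3 * (t * t * u) + t * u * u)) (≤-reflexive (e t u))
  where
  e : ∀ t u → (2 * t + u + t) * (2 * t + u + t) * (2 * t + u + t) + (2 * t + u) * (2 * t + u) * (2 * t + u)
      + (t * t * t + 3 * (t * t * u) + t * u * u)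
      ≡ 2 * ((2 * t + u) * ((2 * t + u + t) * (2 * t + u + t)))
  e = solve-∀

-- The potential and its behaviour under the recursive steps.

-- c ≤ 2ˣ · r^(k x - e) for r = a/(a+1)
Bounded : ℕ → ℕ → ℕ → ℕ → ℕ → Set
Bounded a k c x e = c * (a ^ e * suc a ^ (k * x)) ≤ 2 ^ x * a ^ (k * x) * suc a ^ e

^-step : ∀ a k x b → a ^ (k * (b + x)) ≡ a ^ (k * b) * a ^ (k * x)
^-step a k x b = trans (cong (a ^_) (*-distribˡ-+ k b x)) (^-distribˡ-+-* a (k * b) (k * x))

bounded-weaken : ∀ a k c x {e e′} → e ≤ e′ → Bounded a k c x e → Bounded a k c x e′
bounded-weaken a k c x {e} e≤e′ h with m≤n⇒∃[o]m+o≡n e≤e′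
... | g , refl rewrite ^-distribˡ-+-* a e g | ^-distribˡ-+-* (suc a) e g = begin
  c * (a ^ e * a ^ g * m)             ≡⟨ e₁ c (a ^ e) (a ^ g) m ⟩
  c * (a ^ e * m) * a ^ g             ≤⟨ *-mono-≤ h (^-monoˡ-≤ g (n≤1+n a)) ⟩
  2 ^ x * a ^ (k * x) * suc a ^ e * suc a ^ g ≡⟨ *-assoc (2 ^ x * a ^ (k * x)) _ _ ⟩
  2 ^ x * a ^ (k * x) * (suc a ^ e * suc a ^ g) ∎
  where
  open ≤-Reasoning
  m = suc a ^ (k * x)
  e₁ : ∀ c p q m → c * (p * q * m) ≡ c * (p * m) * q
  e₁ = solve-∀

-- A nonpositive exponent k x - e makes the potential at least 2^x; this closes the leaves of the
-- recursion.
bounded-trivial : ∀ a k c x e → k * x ≤ e → c ≤ 2 ^ x → Bounded a k c x e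
bounded-trivial a k c x e kx≤e c≤ = bounded-weaken a k c x kx≤e
  (≤-trans (*-monoˡ-≤ _ c≤) (≤-reflexive (sym (*-assoc (2 ^ x) _ _))))

-- One branch keeps the budget `e`, the other loses at least 3k of it. Dividing out common factors
-- leaves 1 + r^(3k) ≤ 2 r^k, which is `cubic-bound` at r^k; `3 * k ≤ suc a` ensures r^k ≥ 2/3.
bounded-split : ∀ a k c₁ c₂ c x e e′ → 3 * k ≤ suc a → e′ + k * 3 ≤ e → c ≤ c₁ + c₂ →
                Bounded a k c₁ x e → Bounded a k c₂ x e′ → Bounded a k c (1 + x) e
bounded-split a k c₁ c₂ c x e e′ k-small gap c≤ h₁ h₂ with m≤n⇒∃[o]m+o≡n gap
... | g , refl = begin
  c * (a ^ e * M ^ (k * suc x))             ≤⟨ *-monoˡ-≤ _ c≤ ⟩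
  (c₁ + c₂) * (a ^ e * M ^ (k * suc x))     ≡⟨ cong₂ (λ y z → (c₁ + c₂) * (y * z)) (pow a) stepM ⟩
  (c₁ + c₂) * (u * (P * P * P) * (Q * m))         ≡⟨ r₁ c₁ c₂ u ((P * P * P)) Q m ⟩
  Q * (c₁ * (u * (P * P * P) * m)) + Q * (P * P * P) * (c₂ * (u * m))
    ≤⟨ +-mono-≤ (*-monoʳ-≤ Q h₁′) (*-monoʳ-≤ (Q * (P * P * P)) h₂′) ⟩
  Q * (N * (W * (Q * Q * Q))) + Q * (P * P * P) * (N * W) ≡⟨ r₂ Q N W ((P * P * P)) ((Q * Q * Q)) ⟩
  N * W * Q * ((Q * Q * Q) + (P * P * P))
    ≤⟨ *-monoʳ-≤ (N * W * Q) (cubic-bound P Q (^-monoˡ-≤ k (n≤1+n a)) (power-ratio a k 2 k-small)) ⟩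
  N * W * Q * (2 * (P * (Q * Q)))             ≡⟨ r₃ (2 ^ x) (a ^ (k * x)) W P Q ⟩
  2 * 2 ^ x * (P * a ^ (k * x)) * (W * (Q * Q * Q)) ≡⟨ cong₂ (λ y z → 2 * 2 ^ x * y * z) stepA (pow M) ⟨
  2 ^ suc x * a ^ (k * suc x) * M ^ e       ∎
  where
  open ≤-Reasoning
  M = suc a
  P = a ^ k
  Q = M ^ k
  u = a ^ (e′ + g)
  W = M ^ (e′ + g)
  m = M ^ (k * x)
  N = 2 ^ x * a ^ (k * x)
  cube : ∀ b → b ^ (k * 3) ≡ b ^ k * b ^ k * b ^ k
  cube b = trans (sym (^-*-assoc b k 3))
    (trans (cong (λ z → b ^ k * (b ^ k * z)) (*-identityʳ (b ^ k))) (sym (*-assoc (b ^ k) (b ^ k) (b ^ k))))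
  pow : ∀ b → b ^ (e′ + k * 3 + g) ≡ b ^ (e′ + g) * (b ^ k * b ^ k * b ^ k)
  pow b = trans (cong (b ^_) (trans (+-assoc e′ (k * 3) g)
                (trans (cong (e′ +_) (+-comm (k * 3) g)) (sym (+-assoc e′ g (k * 3))))))
          (trans (^-distribˡ-+-* b (e′ + g) (k * 3)) (cong (b ^ (e′ + g) *_) (cube b)))
  step : ∀ b → b ^ (k * suc x) ≡ b ^ k * b ^ (k * x)
  step b = trans (cong (b ^_) (*-suc k x)) (^-distribˡ-+-* b k (k * x))
  stepM = step M
  stepA = step a
  h₁′ : c₁ * (u * (P * P * P) * m) ≤ N * (W * (Q * Q * Q))
  h₁′ = subst₂ (λ y z → c₁ * (y * m) ≤ N * z) (pow a) (pow M) h₁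
  h₂′ : c₂ * (u * m) ≤ N * W
  h₂′ = bounded-weaken a k c₂ x (m≤m+n e′ g) h₂
  r₁ : ∀ c₁ c₂ u p Q m → (c₁ + c₂) * (u * p * (Q * m)) ≡ Q * (c₁ * (u * p * m)) + Q * p * (c₂ * (u * m))
  r₁ = solve-∀
  r₂ : ∀ Q N W p q → Q * (N * (W * q)) + Q * p * (N * W) ≡ N * W * Q * (q + p)
  r₂ = solve-∀
  r₃ : ∀ t y W P Q → t * y * W * Q * (2 * (P * (Q * Q))) ≡ 2 * t * (P * y) * (W * (Q * Q * Q))
  r₃ = solve-∀

-- Losing one of the 2^b traces leaves a factor 2^b - 1, and `power-ratio` with β = 2^b - 1 bounds 1
-- - 2^(-b) by r^(kb), exactly the change of the potential.
bounded-block : ∀ a k c c′ b x e → 2 ^ b * (k * b) ≤ suc a → c + c′ ≤ 2 ^ b * c′ →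
                Bounded a k c′ x e → Bounded a k c (b + x) e
bounded-block a k c c′ b x e small c≤ h = begin
  c * (a ^ e * M ^ (k * (b + x)))     ≡⟨ cong (λ z → c * (a ^ e * z)) (^-step M k x b) ⟩
  c * (a ^ e * (Q * M ^ (k * x)))     ≤⟨ *-monoˡ-≤ _ c≤βc′ ⟩
  β * c′ * (a ^ e * (Q * M ^ (k * x))) ≡⟨ r₁ β c′ (a ^ e) Q (M ^ (k * x)) ⟩
  β * Q * (c′ * (a ^ e * M ^ (k * x))) ≤⟨ *-mono-≤ ratio h ⟩
  2 ^ b * P * (2 ^ x * a ^ (k * x) * M ^ e) ≡⟨ r₂ (2 ^ b) P (2 ^ x) (a ^ (k * x)) (M ^ e) ⟩
  2 ^ b * 2 ^ x * (P * a ^ (k * x)) * M ^ e ≡⟨ cong₂ (λ y z → y * z * M ^ e) (^-distribˡ-+-* 2 b x) (^-step a k x b) ⟨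
  2 ^ (b + x) * a ^ (k * (b + x)) * M ^ e ∎
  where
  open ≤-Reasoning
  M = suc a
  P = a ^ (k * b)
  Q = M ^ (k * b)
  β = 2 ^ b ∸ 1
  suc-β : suc β ≡ 2 ^ b
  suc-β = m+[n∸m]≡n (m^n>0 2 b)
  c≤βc′ : c ≤ β * c′
  c≤βc′ = +-cancelʳ-≤ c′ c (β * c′)
    (≤-trans c≤ (≤-reflexive (trans (cong (_* c′) (sym suc-β)) (+-comm c′ (β * c′)))))
  ratio : β * Q ≤ 2 ^ b * P
  ratio = subst (λ z → β * Q ≤ z * P) suc-β
    (power-ratio a (k * b) β (subst (λ z → z * (k * b) ≤ M) (sym suc-β) small))
  r₁ : ∀ β c p q m → β * c * (p * (q * m)) ≡ β * q * (c * (p * m))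
  r₁ = solve-∀
  r₂ : ∀ t p s q w → t * p * (s * q * w) ≡ t * s * (p * q) * w
  r₂ = solve-∀

bounded-cancel : ∀ a k c x e g → 0 < a → k * x ≡ e + g → Bounded a k c x e → c * suc a ^ g ≤ 2 ^ x * a ^ g
bounded-cancel a@(suc _) k c x e g _ eq h = *-cancelʳ-≤ _ _ (a ^ e * suc a ^ e)
  {{m*n≢0 _ _ {{m^n≢0 a e}} {{m^n≢0 (suc a) e}}}} (begin
  c * q * (u * w)         ≡⟨ r₁ c q u w ⟩
  c * (u * (w * q))       ≡⟨ cong (λ z → c * (u * z)) (pow (suc a)) ⟨
  c * (u * suc a ^ (k * x)) ≤⟨ h ⟩
  2 ^ x * a ^ (k * x) * w ≡⟨ cong (λ z → 2 ^ x * z * w) (pow a) ⟩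
  2 ^ x * (u * p) * w     ≡⟨ r₂ (2 ^ x) p u w ⟩
  2 ^ x * p * (u * w)     ∎)
  where
  open ≤-Reasoning
  u = a ^ e
  w = suc a ^ e
  p = a ^ g
  q = suc a ^ g
  pow : ∀ b → b ^ (k * x) ≡ b ^ e * b ^ g
  pow b = trans (cong (b ^_) eq) (^-distribˡ-+-* b e g)
  r₁ : ∀ c q u w → c * q * (u * w) ≡ c * (u * (w * q))
  r₁ = solve-∀
  r₂ : ∀ t p u w → t * (u * p) * w ≡ t * p * (u * w)
  r₂ = solve-∀

-- From the potential to a saving in the exponent.

2*m≤n⇒m<n : ∀ {m n} → 0 < n → 2 * m ≤ n → m < n
2*m≤n⇒m<n {zero}  n>0 _ = n>0
2*m≤n⇒m<n {suc m} _   h = ≤-trans (m<m+n (suc m) (s≤s z≤n)) h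

2*a^a≤[1+a]^a : ∀ a → 0 < a → 2 * a ^ a ≤ suc a ^ a
2*a^a≤[1+a]^a a@(suc _) _ = *-cancelʳ-≤ _ _ a (≤-trans (≤-reflexive (r (a ^ a) a)) (bernoulli-above a a))
  where
  r : ∀ p a → 2 * p * a ≡ p * (a + a)
  r = solve-∀

-- c ≤ 2ⁿ r²ⁿ gives the claim because r^a ≤ 1/2 for r = a/(a+1).
power-gap : ∀ a n c → 0 < a → 0 < n → c ≤ 2 ^ n → c * suc a ^ (2 * n) ≤ 2 ^ n * a ^ (2 * n) →
            c ^ suc a < 2 ^ (a * n)
-- The argument yields `c ^ suc a` ≤ 2^(an - n); as n > 0, one spare factor 2 makes the inequality
-- strict.
power-gap a@(suc _) n@(suc _) c a>0 _ c≤2^n h = 2*m≤n⇒m<n (m^n>0 2 (a * n)) (begin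
  2 * c ^ suc a       ≤⟨ *-monoˡ-≤ (c ^ suc a) (^-monoʳ-≤ 2 {1} {n} (s≤s z≤n)) ⟩
  2 ^ n * c ^ suc a   ≤⟨ *-cancelʳ-≤ _ _ (2 ^ n) {{m^n≢0 2 n}} double ⟩
  2 ^ (a * n)         ∎)
  where
  open ≤-Reasoning
  N = 2 * n
  -- Raising the hypothesis to the power a turns r^N into (r^a)^N ≤ 2^(-N).
  powered : c ^ a * 2 ^ N ≤ (2 ^ n) ^ a
  powered = *-cancelʳ-≤ _ _ ((a ^ N) ^ a) {{m^n≢0 (a ^ N) a {{m^n≢0 a N}}}} (begin
    c ^ a * 2 ^ N * (a ^ N) ^ a   ≡⟨ cong (c ^ a * 2 ^ N *_) (^-swap a N a) ⟩
    c ^ a * 2 ^ N * (a ^ a) ^ N   ≡⟨ *-assoc (c ^ a) _ _ ⟩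
    c ^ a * (2 ^ N * (a ^ a) ^ N) ≡⟨ cong (c ^ a *_) (^-distribʳ-* N 2 (a ^ a)) ⟨
    c ^ a * (2 * a ^ a) ^ N       ≤⟨ *-monoʳ-≤ (c ^ a) (^-monoˡ-≤ N (2*a^a≤[1+a]^a a a>0)) ⟩
    c ^ a * (suc a ^ a) ^ N       ≡⟨ cong (c ^ a *_) (^-swap (suc a) a N) ⟩
    c ^ a * (suc a ^ N) ^ a       ≡⟨ ^-distribʳ-* a c (suc a ^ N) ⟨
    (c * suc a ^ N) ^ a           ≤⟨ ^-monoˡ-≤ a h ⟩
    (2 ^ n * a ^ N) ^ a           ≡⟨ ^-distribʳ-* a (2 ^ n) (a ^ N) ⟩
    (2 ^ n) ^ a * (a ^ N) ^ a     ∎)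
  double : 2 ^ n * c ^ suc a * 2 ^ n ≤ 2 ^ (a * n) * 2 ^ n
  double = begin
    2 ^ n * (c * c ^ a) * 2 ^ n   ≡⟨ r c (c ^ a) (2 ^ n) ⟩
    c * (c ^ a * (2 ^ n * 2 ^ n)) ≡⟨ cong (λ z → c * (c ^ a * z)) (^-distribˡ-+-* 2 n n) ⟨
    c * (c ^ a * 2 ^ (n + n))     ≡⟨ cong (λ z → c * (c ^ a * 2 ^ (n + z))) (+-identityʳ n) ⟨
    c * (c ^ a * 2 ^ N)           ≤⟨ *-mono-≤ c≤2^n powered ⟩
    2 ^ n * (2 ^ n) ^ a           ≡⟨ *-comm (2 ^ n) _ ⟩
    (2 ^ n) ^ a * 2 ^ n           ≡⟨ cong (_* 2 ^ n) (trans (^-*-assoc 2 n a) (cong (2 ^_) (*-comm n a))) ⟩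
    2 ^ (a * n) * 2 ^ n           ∎
    where
    r : ∀ c p t → t * (c * p) * t ≡ c * (p * (t * t))
    r = solve-∀

-- Counting the subsets of a set that satisfy a predicate.

private variable
  n m : ℕ
  P Q : Subset n → Set

infixl 5 _∖_
_∖_ : Subset n → Subset n → Subset n
p ∖ q = p ∩ ∁ q

p∖⊥≡p : ∀ (p : Subset n) → p ∖ ⊥ ≡ p
p∖⊥≡p p = trans (cong (p ∩_) (map-replicate not false _)) (∩-identityʳ p)

-- Recursion over coordinates, specialising the predicate one bit at a time, lets the counting
-- inequalities go by induction on the vectors.
count⊆ : Subset n → {P : Subset n → Set} → Decidable P → ℕ
count⊆ []          P? = if does (P? []) then 1 else 0
count⊆ (false ∷ X) P? = count⊆ X (λ S → P? (false ∷ S))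
count⊆ (true  ∷ X) P? = count⊆ X (λ S → P? (false ∷ S)) + count⊆ X (λ S → P? (true ∷ S))

count⊆-mono : ∀ (X : Subset n) (P? : Decidable P) (Q? : Decidable Q) →
              (∀ S → P S → Q S) → count⊆ X P? ≤ count⊆ X Q?
count⊆-mono [] P? Q? h with P? [] | Q? []
... | yes p | yes q = ≤-refl
... | yes p | no ¬q = contradiction (h [] p) ¬q
... | no ¬p | _     = z≤n
count⊆-mono (false ∷ X) P? Q? h = count⊆-mono X _ _ (λ S → h (false ∷ S))
count⊆-mono (true ∷ X)  P? Q? h =
  +-mono-≤ (count⊆-mono X _ _ (λ S → h (false ∷ S))) (count⊆-mono X _ _ (λ S → h (true ∷ S)))

count⊆≤2^ : ∀ (X : Subset n) (P? : Decidable P) → count⊆ X P? ≤ 2 ^ ∣ X ∣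
count⊆≤2^ [] P? with does (P? [])
... | true  = ≤-refl
... | false = z≤n
count⊆≤2^ (false ∷ X) P? = count⊆≤2^ X _
count⊆≤2^ (true ∷ X)  P? = +-mono-≤ (count⊆≤2^ X _) (≤-trans (count⊆≤2^ X _) (m≤m+n _ 0))

⊆-cons : ∀ b {S S′ : Subset n} → S′ ⊆ S → b ∷ S′ ⊆ b ∷ S
⊆-cons b h here      = here
⊆-cons b h (there i) = there (h i)

⊆-grow : ∀ {b} {S S′ : Subset n} → S′ ⊆ S → false ∷ S′ ⊆ b ∷ S
⊆-grow h (there i) = there (h i)

-- Deleting `x` maps the sets containing it injectively to sets satisfying `Q`; the others are
-- already subsets of the smaller ground set. The premise ranges over every S′ below S so that it
-- survives fixing a coordinate.
count⊆-split : ∀ {x} {X : Subset n} (P? : Decidable P) (Q? : Decidable Q) → x ∈ X →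
  (∀ {S S′} → S′ ⊆ S → x ∈ S → x ∉ S′ → P S → Q S′) →
  count⊆ X P? ≤ count⊆ (X ∖ ⁅ x ⁆) P? + count⊆ (X ∖ ⁅ x ⁆) Q?
count⊆-split {x = zero} {true ∷ X} P? Q? here h rewrite p∖⊥≡p X =
  +-monoʳ-≤ (count⊆ X _) (count⊆-mono X _ _ λ S → h (⊆-grow (λ i → i)) here λ ())
count⊆-split {x = suc x} {false ∷ X} P? Q? (there x∈X) h =
  count⊆-split _ _ x∈X λ s i o → h (⊆-cons false s) (there i) (λ { (there i) → o i })
count⊆-split {x = suc x} {true ∷ X} P? Q? (there x∈X) h = begin
  _ ≤⟨ +-mono-≤ (count⊆-split _ (λ S → Q? (false ∷ S)) x∈X λ s i o → h (⊆-cons false s) (there i) (λ { (there i) → o i }))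
                (count⊆-split _ (λ S → Q? (true ∷ S)) x∈X λ s i o → h (⊆-cons true s) (there i) (λ { (there i) → o i })) ⟩
  _ ≡⟨ +-interchange (count⊆ (X ∖ ⁅ x ⁆) (λ S → P? (false ∷ S))) _ _ _ ⟩
  _ ∎
  where
  open ≤-Reasoning

-- Removing `B` from a set yields a set satisfying `Q`, and each result arises from at most 2^∣ B ∣
-- sets, one per trace on `B`.
count⊆-block : ∀ (X B : Subset n) (P? : Decidable P) (Q? : Decidable Q) →
  (∀ {S S′} → S′ ⊆ S → P S → Q S′) → count⊆ X P? ≤ 2 ^ ∣ B ∣ * count⊆ (X ∖ B) Q?
count⊆-block [] [] P? Q? h = ≤-trans (count⊆-mono [] P? Q? λ S → h (λ i → i)) (m≤m+n _ 0)
count⊆-block (false ∷ X) (false ∷ B) P? Q? h = count⊆-block X B _ _ (h ∘ ⊆-cons false)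
count⊆-block (false ∷ X) (true ∷ B) P? Q? h =
  ≤-trans (count⊆-block X B _ _ (h ∘ ⊆-cons false))
          (*-monoˡ-≤ _ (m≤m+n (2 ^ ∣ B ∣) _))
count⊆-block (true ∷ X) (false ∷ B) P? Q? h =
  ≤-trans (+-mono-≤ (count⊆-block X B _ _ (h ∘ ⊆-cons false)) (count⊆-block X B _ _ (h ∘ ⊆-cons true)))
          (≤-reflexive (sym (*-distribˡ-+ (2 ^ ∣ B ∣) _ _)))
count⊆-block (true ∷ X) (true ∷ B) P? Q? h =
  ≤-trans (+-mono-≤ (count⊆-block X B _ _ (h ∘ ⊆-cons false)) (count⊆-block X B _ _ (h ∘ ⊆-grow)))
          (≤-reflexive (m*n+m*n≡2*m*n (2 ^ ∣ B ∣) _))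

-- The full trace on B is missing, hence a factor 2^∣ B ∣ - 1; the subtrahend is moved to the left.
count⊆-avoid : ∀ (X B : Subset n) (P? : Decidable P) (Q? : Decidable Q) →
  (∀ {S S′} → S′ ⊆ S → P S → Q S′) → (∀ {S} → B ⊆ S → ¬ P S) →
  count⊆ X P? + count⊆ (X ∖ B) Q? ≤ 2 ^ ∣ B ∣ * count⊆ (X ∖ B) Q?
count⊆-avoid [] [] P? Q? h av with P? []
... | yes p = contradiction p (av λ i → i)
... | no _  = m≤m+n _ 0
count⊆-avoid (false ∷ X) (false ∷ B) P? Q? h av =
  count⊆-avoid X B _ _ (h ∘ ⊆-cons false) (av ∘ ⊆-cons false)
-- This vertex of `B` lies outside `X`: the factor doubles without new sets, so the plain block
-- bound leaves room for the subtrahend.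
count⊆-avoid (false ∷ X) (true ∷ B) P? Q? h av = begin
  c + d                     ≤⟨ +-monoˡ-≤ d (count⊆-block X B _ _ (h ∘ ⊆-cons false)) ⟩
  2 ^ ∣ B ∣ * d + d         ≤⟨ +-monoʳ-≤ _ (≤-trans (m≤m+n d 0) (*-monoˡ-≤ d (m^n>0 2 ∣ B ∣))) ⟩
  2 ^ ∣ B ∣ * d + 2 ^ ∣ B ∣ * d ≡⟨ m*n+m*n≡2*m*n (2 ^ ∣ B ∣) d ⟩
  2 * 2 ^ ∣ B ∣ * d         ∎
  where
  open ≤-Reasoning
  c = count⊆ X (λ S → P? (false ∷ S))
  d = count⊆ (X ∖ B) (λ S → Q? (false ∷ S))
count⊆-avoid (true ∷ X) (false ∷ B) P? Q? h av = begin
  _ ≡⟨ +-interchange (count⊆ X (λ S → P? (false ∷ S))) _ _ _ ⟩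
  _ ≤⟨ +-mono-≤ (count⊆-avoid X B _ _ (h ∘ ⊆-cons false) (av ∘ ⊆-cons false))
                (count⊆-avoid X B _ _ (h ∘ ⊆-cons true) (av ∘ ⊆-grow)) ⟩
  _ ≡⟨ *-distribˡ-+ (2 ^ ∣ B ∣) _ _ ⟨
  _ ∎
  where
  open ≤-Reasoning
-- Only sets containing this vertex can contain all of `B`; the loss is taken in that half and the
-- other half gets the block bound.
count⊆-avoid (true ∷ X) (true ∷ B) P? Q? h av = begin
  c₀ + c₁ + d             ≡⟨ +-assoc c₀ c₁ d ⟩
  c₀ + (c₁ + d)           ≤⟨ +-mono-≤ (count⊆-block X B _ _ (h ∘ ⊆-cons false))
                                      (count⊆-avoid X B _ _ (h ∘ ⊆-grow) (av ∘ ⊆-cons true)) ⟩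
  2 ^ ∣ B ∣ * d + 2 ^ ∣ B ∣ * d ≡⟨ m*n+m*n≡2*m*n (2 ^ ∣ B ∣) d ⟩
  2 * 2 ^ ∣ B ∣ * d       ∎
  where
  open ≤-Reasoning
  c₀ = count⊆ X (λ S → P? (false ∷ S))
  c₁ = count⊆ X (λ S → P? (true ∷ S))
  d = count⊆ (X ∖ B) (λ S → Q? (false ∷ S))

length-filter-map : ∀ {A B : Set} {P : B → Set} (P? : Decidable P) (f : A → B) xs →
                    length (filter P? (map f xs)) ≡ length (filter (λ x → P? (f x)) xs)
length-filter-map P? f [] = refl
length-filter-map P? f (x ∷ xs) with does (P? (f x))
... | true  = cong suc (length-filter-map P? f xs)
... | false = length-filter-map P? f xs

count⊆-⊤ : ∀ n {P : Subset n → Set} (P? : Decidable P) → length (filter P? (subsets n)) ≡ count⊆ ⊤ P?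
count⊆-⊤ zero P? with does (P? [])
... | true  = refl
... | false = refl
count⊆-⊤ (suc n) P? = begin
  length (filter P? (S₀ ++ S₁))                    ≡⟨ cong length (filter-++ P? S₀ S₁) ⟩
  length (filter P? S₀ ++ filter P? S₁)            ≡⟨ length-++ (filter P? S₀) ⟩
  length (filter P? S₀) + length (filter P? S₁)
    ≡⟨ cong₂ _+_ (length-filter-map P? _ (subsets n)) (length-filter-map P? _ (subsets n)) ⟩
  length (filter (λ S → P? (false ∷ S)) (subsets n)) + length (filter (λ S → P? (true ∷ S)) (subsets n))
    ≡⟨ cong₂ _+_ (count⊆-⊤ n _) (count⊆-⊤ n _) ⟩
  count⊆ ⊤ P?                                    ∎
  where
  open ≡-Reasoning
  S₀ = map (false ∷_) (subsets n)
  S₁ = map (true ∷_) (subsets n)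

-- Cardinalities and enumeration of finite sets.

∣p∪q∣≤∣p∣+∣q∣ : ∀ (p q : Subset n) → ∣ p ∪ q ∣ ≤ ∣ p ∣ + ∣ q ∣
∣p∪q∣≤∣p∣+∣q∣ []          []          = z≤n
∣p∪q∣≤∣p∣+∣q∣ (false ∷ p) (false ∷ q) = ∣p∪q∣≤∣p∣+∣q∣ p q
∣p∪q∣≤∣p∣+∣q∣ (false ∷ p) (true ∷ q)  =
  ≤-trans (s≤s (∣p∪q∣≤∣p∣+∣q∣ p q)) (≤-reflexive (sym (+-suc ∣ p ∣ ∣ q ∣)))
∣p∪q∣≤∣p∣+∣q∣ (true ∷ p)  (false ∷ q) = s≤s (∣p∪q∣≤∣p∣+∣q∣ p q)
∣p∪q∣≤∣p∣+∣q∣ (true ∷ p)  (true ∷ q)  =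
  s≤s (≤-trans (∣p∪q∣≤∣p∣+∣q∣ p q) (+-monoʳ-≤ ∣ p ∣ (n≤1+n ∣ q ∣)))

x∈p⇒⁅x⁆⊆p : ∀ {x} {p : Subset n} → x ∈ p → ⁅ x ⁆ ⊆ p
x∈p⇒⁅x⁆⊆p {x = x} x∈p y∈⁅x⁆ = subst (_∈ _) (sym (x∈⁅y⁆⇒x≡y x y∈⁅x⁆)) x∈p

⁅x⁆∪q⊆p : ∀ {x} {p q : Subset n} → x ∈ p → q ⊆ p → ⁅ x ⁆ ∪ q ⊆ p
⁅x⁆∪q⊆p {x = x} {q = q} x∈p q⊆p i = [ x∈p⇒⁅x⁆⊆p x∈p , q⊆p ]′ (x∈p∪q⁻ ⁅ x ⁆ q i)

∣⁅x⁆∪q∣≤1+∣q∣ : ∀ x (q : Subset n) → ∣ ⁅ x ⁆ ∪ q ∣ ≤ suc ∣ q ∣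
∣⁅x⁆∪q∣≤1+∣q∣ x q =
  ≤-trans (∣p∪q∣≤∣p∣+∣q∣ ⁅ x ⁆ q) (≤-reflexive (cong (_+ ∣ q ∣) (∣⁅x⁆∣≡1 x)))

q⊆p⇒∣q∣+∣p∖q∣≡∣p∣ : ∀ (p q : Subset n) → q ⊆ p → ∣ q ∣ + ∣ p ∖ q ∣ ≡ ∣ p ∣
q⊆p⇒∣q∣+∣p∖q∣≡∣p∣ []          []          q⊆p = refl
q⊆p⇒∣q∣+∣p∖q∣≡∣p∣ (false ∷ p) (false ∷ q) q⊆p = q⊆p⇒∣q∣+∣p∖q∣≡∣p∣ p q (drop-∷-⊆ q⊆p)
q⊆p⇒∣q∣+∣p∖q∣≡∣p∣ (false ∷ p) (true ∷ q)  q⊆p with () ← q⊆p here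
q⊆p⇒∣q∣+∣p∖q∣≡∣p∣ (true ∷ p)  (false ∷ q) q⊆p =
  trans (+-suc ∣ q ∣ _) (cong suc (q⊆p⇒∣q∣+∣p∖q∣≡∣p∣ p q (drop-∷-⊆ q⊆p)))
q⊆p⇒∣q∣+∣p∖q∣≡∣p∣ (true ∷ p)  (true ∷ q)  q⊆p = cong suc (q⊆p⇒∣q∣+∣p∖q∣≡∣p∣ p q (drop-∷-⊆ q⊆p))

enumerate : (X : Subset n) → Σ (Fin ∣ X ∣ → Fin n) λ f → Injective _≡_ _≡_ f × (∀ i → f i ∈ X)
enumerate []          = (λ ()) , (λ { {()} }) , λ ()
enumerate (false ∷ X) with enumerate X
... | f , inj , mem = suc ∘ f , inj ∘ Fin.suc-injective , there ∘ mem
enumerate (true ∷ X) with enumerate X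
... | f , inj , mem = f′ , inj′ , mem′
  where
  f′ : Fin (suc ∣ X ∣) → Fin _
  f′ zero    = zero
  f′ (suc i) = suc (f i)
  inj′ : Injective _≡_ _≡_ f′
  inj′ {zero}  {zero}  _  = refl
  inj′ {suc i} {suc j} eq = cong suc (inj (Fin.suc-injective eq))
  mem′ : ∀ i → f′ i ∈ true ∷ X
  mem′ zero    = here
  mem′ (suc i) = there (mem i)

length-filter-partition : ∀ {A : Set} {P : A → Set} (P? : Decidable P) xs →
  length (filter (λ x → ¬? (P? x)) xs) + length (filter P? xs) ≡ length xs
length-filter-partition P? [] = refl
length-filter-partition P? (x ∷ xs) with does (P? x)
... | true  = trans (+-suc _ _) (cong suc (length-filter-partition P? xs))
... | false = cong suc (length-filter-partition P? xs)

-- Private neighbours, irredundant sets and obstructions to irredundance.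

module _ (G : BipGraph n m) where

  Private : Subset n → Fin n → Fin m → Set
  Private S x y = G x y ≡ true × (∀ x′ → x′ ∈ S → G x′ y ≡ true → x′ ≡ x)

  Shared : Subset n → Fin n → Fin m → Set
  Shared S x y = ∃ λ x′ → x′ ∈ S × x′ ≢ x × G x′ y ≡ true

  -- Private neighbours are sought only in `Ys`, which shrinks along the recursion; the full list
  -- `allFin m` gives ordinary irredundance.
  Irredundant : List (Fin m) → Subset n → Set
  Irredundant Ys S = ∀ x → x ∈ S → Any (Private S x) Ys

  private? : ∀ S x y → Dec (Private S x y)
  private? S x y = (G x y ≟ᵇ true) ×-dec
    Fin.all? λ x′ → (x′ ∈? S) →-dec ((G x′ y ≟ᵇ true) →-dec (x′ ≟ x))

  hasPrivate? : ∀ Ys S x → Dec (x ∈ S → Any (Private S x) Ys)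
  hasPrivate? Ys S x = (x ∈? S) →-dec Any.any? (private? S x) Ys

  irredundant? : ∀ Ys → Decidable (Irredundant Ys)
  irredundant? Ys S = Fin.all? (hasPrivate? Ys S)

  ¬private⇒shared : ∀ {S x y} → ¬ Private S x y → G x y ≡ true → Shared S x y
  ¬private⇒shared {S} {x} {y} ¬p gxy
    with Fin.any? (λ x′ → (x′ ∈? S) ×-dec (¬? (x′ ≟ x) ×-dec (G x′ y ≟ᵇ true)))
  ... | yes shared = shared
  ... | no ¬shared = contradiction (gxy , only) ¬p
    where
    only : ∀ x′ → x′ ∈ S → G x′ y ≡ true → x′ ≡ x
    only x′ i g with x′ ≟ x
    ... | yes eq = eq
    ... | no ¬eq = contradiction (x′ , i , ¬eq , g) ¬shared

  irredundant-⊆ : ∀ Ys {S S′} → S′ ⊆ S → Irredundant Ys S → Irredundant Ys S′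
  irredundant-⊆ Ys S′⊆S irr x x∈S′ =
    Any.map (λ { (g , only) → g , λ x′ i → only x′ (S′⊆S i) }) (irr x (S′⊆S x∈S′))

  neighbours nonNeighbours : Fin n → List (Fin m) → List (Fin m)
  neighbours x = filter (λ y → G x y ≟ᵇ true)
  nonNeighbours x = filter (λ y → ¬? (G x y ≟ᵇ true))

  -- While `x` is in `S`, no neighbour of `x` is private to another vertex, so the private
  -- neighbours of the vertices of `S′` all survive the removal.
  irredundant-delete : ∀ Ys {x S S′} → S′ ⊆ S → x ∈ S → x ∉ S′ →
                       Irredundant Ys S → Irredundant (nonNeighbours x Ys) S′
  irredundant-delete Ys {x} S′⊆S x∈S x∉S′ irr z z∈S′ = keep Ys (irr z (S′⊆S z∈S′))
    where
    keep : ∀ Ys → Any (Private _ z) Ys → Any (Private _ z) (nonNeighbours x Ys)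
    keep (y ∷ Ys) a with G x y ≟ᵇ true | a
    ... | yes g | here (_ , only) = contradiction (subst (_∈ _) (sym (only x x∈S g)) z∈S′) x∉S′
    ... | yes g | there a         = keep Ys a
    ... | no _  | here (g , only) = here (g , λ x′ i → only x′ (S′⊆S i))
    ... | no _  | there a         = there (keep Ys a)

  irredundant⇒matching : ∀ Ys X → Irredundant Ys X → InducedMatching G ∣ X ∣
  irredundant⇒matching Ys X irr with enumerate X
  ... | f , inj , mem = f , g , inj , g-inj , λ i j → mk⇔ (edge⇒≡ i j) λ { refl → proj₁ (priv i) }
    where
    g : Fin ∣ X ∣ → Fin m
    g i = proj₁ (Any.satisfied (irr (f i) (mem i)))
    priv : ∀ i → Private X (f i) (g i)
    priv i = proj₂ (Any.satisfied (irr (f i) (mem i)))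
    edge⇒≡ : ∀ i j → G (f i) (g j) ≡ true → i ≡ j
    edge⇒≡ i j e = inj (proj₂ (priv j) (f i) (mem i) e)
    g-inj : Injective _≡_ _≡_ g
    g-inj {i} {j} eq = edge⇒≡ i j (subst (λ y → G (f i) y ≡ true) eq (proj₁ (priv i)))

  -- One element of `X` is chosen for each neighbour of `x` in `Ys`, which bounds `B`. A chosen
  -- element still shares its neighbour in every set containing `B`.
  sharers : ∀ X x Ys → All (λ y → G x y ≡ true → Shared X x y) Ys →
    Σ (Subset n) λ B → B ⊆ X × ∣ B ∣ ≤ length (neighbours x Ys) ×
      (∀ {S} → B ⊆ S → All (λ y → G x y ≡ true → Shared S x y) Ys)
  sharers X x [] [] = ⊥ , ⊥-elim ∘ ∉⊥ , ≤-reflexive (∣⊥∣≡0 n) , λ _ → []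
  sharers X x (y ∷ Ys) (sh ∷ shs) with sharers X x Ys shs | G x y ≟ᵇ true
  ... | B , B⊆X , B≤ , all-shared | no ¬g =
    B , B⊆X , B≤ , λ B⊆S → (λ g → contradiction g ¬g) ∷ all-shared B⊆S
  ... | B , B⊆X , B≤ , all-shared | yes g with sh g
  ...   | x′ , x′∈X , x′≢x , g′ =
        ⁅ x′ ⁆ ∪ B , ⁅x⁆∪q⊆p x′∈X B⊆X , ≤-trans (∣⁅x⁆∪q∣≤1+∣q∣ x′ B) (s≤s B≤) , λ B⊆S →
          (λ _ → x′ , B⊆S (p⊆p∪q B (x∈⁅x⁆ x′)) , x′≢x , g′) ∷ all-shared (B⊆S ∘ q⊆p∪q ⁅ x′ ⁆ B)

  -- Some `x` in `X` has no private neighbour. Together with its sharers it forms `B`, and in any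
  -- set containing `B` it still has none. The vertex `x` is returned as well, since the recursion
  -- may branch on it.
  ¬irredundant⇒block : ∀ X Ys → ¬ Irredundant Ys X →
    Σ (Fin n) λ x → Σ (Subset n) λ B → x ∈ B × B ⊆ X ×
      ∣ B ∣ ≤ suc (length (neighbours x Ys)) × (∀ {S} → B ⊆ S → ¬ Irredundant Ys S)
  ¬irredundant⇒block X Ys ¬irr with Fin.¬∀⟶∃¬ n _ (hasPrivate? Ys X) ¬irr
  ... | x , ¬h with x ∈? X
  ...   | no x∉X = contradiction (λ x∈X → contradiction x∈X x∉X) ¬h
  ...   | yes x∈X with sharers X x Ys
                    (All.map (λ ¬p → ¬private⇒shared ¬p) (¬Any⇒All¬ Ys λ a → ¬h λ _ → a))
  ...     | B , B⊆X , B≤ , all-shared =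
    x , ⁅ x ⁆ ∪ B , x∈B , ⁅x⁆∪q⊆p x∈X B⊆X , ≤-trans (∣⁅x⁆∪q∣≤1+∣q∣ x B) (s≤s B≤) , λ B⊆S irr →
      clash (all-shared (B⊆S ∘ q⊆p∪q ⁅ x ⁆ B)) (irr x (B⊆S x∈B))
    where
    x∈B : x ∈ ⁅ x ⁆ ∪ B
    x∈B = p⊆p∪q B (x∈⁅x⁆ x)
    clash : ∀ {S Ys} → All (λ y → G x y ≡ true → Shared S x y) Ys → ¬ Any (Private S x) Ys
    clash (sh ∷ _)  (here (g , only)) with sh g
    ... | x′ , i , x′≢x , g′ = x′≢x (only x′ i g′)
    clash (_ ∷ shs) (there a) = clash shs a

  -- The Boolean test is translated in this direction because `irr` is bounded from above.
  irredundant-sound : ∀ S → irredundant G S ≡ true → Irredundant (allFin m) S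
  irredundant-sound S eq x x∈S with All.lookup (all⁺ _ (allFin n) (Equivalence.from T-≡ eq)) (∈-allFin x)
  ... | t rewrite []=⇒lookup x∈S = Any.map priv (any⁻ _ (allFin m) t)
    where
    alone : Fin m → Fin n → Bool
    alone y x′ = not (lookup S x′) ∨ ⌊ x′ ≟ x ⌋ ∨ not (G x′ y)
    only : ∀ {y} x′ → True (alone y x′) → x′ ∈ S → G x′ y ≡ true → x′ ≡ x
    only x′ t i g rewrite []=⇒lookup i | g with x′ ≟ x
    ... | yes e = e
    ... | no _  = ⊥-elim t
    priv : ∀ {y} → True (G x y ∧ all (alone y) (allFin n)) → Private S x y
    priv {y} t with Equivalence.to (T-∧ {G x y}) t
    ... | g , others = Equivalence.to T-≡ g , λ x′ →
      only x′ (All.lookup (all⁺ (alone y) (allFin n) others) (∈-allFin x′))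

  irr≤count⊆ : irr G ≤ count⊆ ⊤ (irredundant? (allFin m))
  irr≤count⊆ = ≤-trans (≤-reflexive (count⊆-⊤ n (λ S → irredundant G S ≟ᵇ true)))
                       (count⊆-mono ⊤ _ _ irredundant-sound)

-- The branching recursion.

-- If `X` is irredundant, it gives a matching, so k∣X∣ ≤ s and the trivial count suffices. Otherwise
-- either a branch on `x` uses up 3k elements of `Ys`, or a small block loses a trace. Each step
-- removes `x`, so `fuel` bounds ∣X∣.
irredundant-count-bounded : ∀ {n m} (G : BipGraph n m) a k s →
  3 * k ≤ suc a → (∀ b → b ≤ k * 3 → 2 ^ b * (k * b) ≤ suc a) →
  (∀ j → InducedMatching G j → k * j ≤ s) →
  ∀ fuel X Ys → ∣ X ∣ ≤ fuel → Bounded a k (count⊆ X (irredundant? G Ys)) ∣ X ∣ (s + length Ys)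
irredundant-count-bounded {n} G a k s 3k≤ block-small no-matching = go
  where
  N : Subset n → List _ → ℕ
  N X Ys = count⊆ X (irredundant? G Ys)

  go : ∀ fuel X Ys → ∣ X ∣ ≤ fuel → Bounded a k (N X Ys) ∣ X ∣ (s + length Ys)
  go fuel X Ys X≤ with irredundant? G Ys X
  ... | yes irr = bounded-trivial a k _ ∣ X ∣ (s + length Ys)
          (≤-trans (no-matching _ (irredundant⇒matching G Ys X irr)) (m≤m+n s _)) (count⊆≤2^ X _)
  ... | no ¬irr with ¬irredundant⇒block G X Ys ¬irr
  ...   | x , B , x∈B , B⊆X , B≤ , avoid = step fuel X≤
    where
    fewer : ∀ {fuel} C → x ∈ C → C ⊆ X → ∣ X ∣ ≤ suc fuel → ∣ X ∖ C ∣ ≤ fuel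
    fewer C x∈C C⊆X X≤ = s≤s⁻¹ (≤-trans (m<n+m _ (≤-trans (s≤s z≤n) (x∈p⇒∣p-x∣<∣p∣ x∈C)))
                                       (≤-trans (≤-reflexive (q⊆p⇒∣q∣+∣p∖q∣≡∣p∣ X C C⊆X)) X≤))

    step : ∀ fuel → ∣ X ∣ ≤ fuel → Bounded a k (N X Ys) ∣ X ∣ (s + length Ys)
    step zero X≤0 = bounded-trivial a k _ ∣ X ∣ (s + length Ys)
      (≤-trans (*-monoʳ-≤ k X≤0) (≤-trans (≤-reflexive (*-zeroʳ k)) z≤n)) (count⊆≤2^ X _)
    step (suc fuel) X≤ with k * 3 ≤? length (neighbours G x Ys)
    ... | yes large = subst (λ z → Bounded a k (N X Ys) z (s + length Ys)) size
            (bounded-split a k (N X′ Ys) (N X′ Ys′) _ ∣ X′ ∣ _ (s + length Ys′) 3k≤ gap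
              (count⊆-split _ _ (B⊆X x∈B) (irredundant-delete G Ys))
              (go fuel X′ Ys X′≤) (go fuel X′ Ys′ X′≤))
      where
      X′ = X ∖ ⁅ x ⁆
      Ys′ = nonNeighbours G x Ys
      size : 1 + ∣ X′ ∣ ≡ ∣ X ∣
      size = trans (cong (_+ ∣ X′ ∣) (sym (∣⁅x⁆∣≡1 x))) (q⊆p⇒∣q∣+∣p∖q∣≡∣p∣ X ⁅ x ⁆ (x∈p⇒⁅x⁆⊆p (B⊆X x∈B)))
      X′≤ : ∣ X′ ∣ ≤ fuel
      X′≤ = s≤s⁻¹ (≤-trans (≤-reflexive size) X≤)
      gap : s + length Ys′ + k * 3 ≤ s + length Ys
      gap = begin
        s + length Ys′ + k * 3                        ≤⟨ +-monoʳ-≤ _ large ⟩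
        s + length Ys′ + length (neighbours G x Ys)   ≡⟨ +-assoc s _ _ ⟩
        s + (length Ys′ + length (neighbours G x Ys)) ≡⟨ cong (s +_) (length-filter-partition _ Ys) ⟩
        s + length Ys                                 ∎
        where open ≤-Reasoning
    ... | no small = subst (λ z → Bounded a k (N X Ys) z (s + length Ys))
            (q⊆p⇒∣q∣+∣p∖q∣≡∣p∣ X B B⊆X)
            (bounded-block a k _ (N (X ∖ B) Ys) ∣ B ∣ ∣ X ∖ B ∣ (s + length Ys)
              -- Fewer than 3k neighbours leave room for `x` itself: ∣B∣ is at most their number
              -- plus one, hence at most 3k.
              (block-small ∣ B ∣ (≤-trans B≤ (≰⇒> small)))
              (count⊆-avoid X B _ _ (irredundant-⊆ G Ys) avoid)
              (go fuel (X ∖ B) Ys (fewer B x∈B B⊆X X≤)))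

-- Choice of the constants and conclusion.

-- The case ε ≥ 1/(τ+1), with δ = 1/(a+1).
irr-gap : ∀ τ n (G : BipGraph n (2 * n)) → let T = suc τ; a = 2 ^ (20 * T) in
  0 < n → (∀ j → InducedMatching G j → T * j ≤ τ * n) → irr G ^ suc a < 2 ^ (a * n)
irr-gap τ n G n>0 no-matching = power-gap a n (irr G) a>0 n>0 irr≤2^n
  (≤-trans (*-monoˡ-≤ _ (irr≤count⊆ G)) (bounded-cancel a k c n e (2 * n) a>0 exponent bounded))
  where
  open ≤-Reasoning
  T = suc τ
  -- The blocks dictate 20 = 12 + 3 + 5: for b ≤ 12T one has 2^b ≤ 2^(12T), k ≤ 2^(3T) and b ≤
  -- 2^(5T).
  a = 2 ^ (20 * T)
  -- The factor 4 leaves the exponent kn - (s + 2n) = 4n - 2n = 2n required by `power-gap`, where 2n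
  -- is the size of Y.
  k = 4 * T
  s = 4 * (τ * n)
  e = s + 2 * n
  c = count⊆ ⊤ (irredundant? G (allFin (2 * n)))
  a>0 : 0 < a
  a>0 = m^n>0 2 (20 * T)
  irr≤2^n : irr G ≤ 2 ^ n
  irr≤2^n = ≤-trans (irr≤count⊆ G)
    (≤-trans (count⊆≤2^ ⊤ (irredundant? G (allFin (2 * n)))) (≤-reflexive (cong (2 ^_) (∣⊤∣≡n n))))
  exponent : k * n ≡ e + 2 * n
  exponent = r τ n
    where
    r : ∀ τ n → 4 * suc τ * n ≡ 4 * (τ * n) + 2 * n + 2 * n
    r = solve-∀
  3k≤ : 3 * k ≤ suc a
  3k≤ = begin
    3 * (4 * T)   ≡⟨ *-assoc 3 4 T ⟨
    12 * T        ≤⟨ *≤2^ 4 τ (m≤m+n 12 4) ⟩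
    2 ^ (5 * T)   ≤⟨ ^-monoʳ-≤ 2 (*-monoˡ-≤ T (m≤m+n 5 15)) ⟩
    a             ≤⟨ n≤1+n a ⟩
    suc a         ∎
  block-small : ∀ b → b ≤ k * 3 → 2 ^ b * (k * b) ≤ suc a
  block-small b b≤ = begin
    2 ^ b * (k * b)
      ≤⟨ *-mono-≤ (^-monoʳ-≤ 2 b≤12T) (*-mono-≤ (*≤2^ 2 τ ≤-refl) (≤-trans b≤12T (*≤2^ 4 τ (m≤m+n 12 4)))) ⟩
    2 ^ (12 * T) * (2 ^ (3 * T) * 2 ^ (5 * T)) ≡⟨ cong (2 ^ (12 * T) *_) (^-distribˡ-+-* 2 (3 * T) (5 * T)) ⟨
    2 ^ (12 * T) * 2 ^ (3 * T + 5 * T)  ≡⟨ ^-distribˡ-+-* 2 (12 * T) (3 * T + 5 * T) ⟨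
    2 ^ (12 * T + (3 * T + 5 * T))      ≡⟨ cong (2 ^_) (r T) ⟩
    a                                   ≤⟨ n≤1+n a ⟩
    suc a                               ∎
    where
    r : ∀ T → 12 * T + (3 * T + 5 * T) ≡ 20 * T
    r = solve-∀
    b≤12T : b ≤ 12 * T
    b≤12T = ≤-trans b≤ (≤-reflexive (r′ T))
      where
      r′ : ∀ T → 4 * T * 3 ≡ 12 * T
      r′ = solve-∀
  bounded : Bounded a k c n e
  bounded = subst₂ (λ x l → Bounded a k c x (s + l)) (∣⊤∣≡n n) (length-tabulate {n = 2 * n} (λ i → i))
    (irredundant-count-bounded G a k s 3k≤ block-small
      (λ j M → ≤-trans (≤-reflexive (*-assoc 4 T j)) (*-monoʳ-≤ 4 (no-matching j M)))
      n ⊤ (allFin (2 * n)) (≤-reflexive (∣⊤∣≡n n)))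

-- Rational encoding: C = e/f, ε = a/b and δ = c/d. The power inequality says δ ≥ 2^(-C/ε), and the
-- last one is log irr(G) < (1-δ)n multiplied by d and exponentiated.
theorem4p2 : Σ ℕ λ e → Σ ℕ λ f → 0 < e × 0 < f ×
    (∀ a b → 0 < a → 0 < b →
    Σ ℕ λ c → Σ ℕ λ d → 0 < d ×
    d ^ (f * a) ≤ c ^ (f * a) * 2 ^ (e * b) ×
    (∀ n (G : BipGraph n (2 * n)) →
    (∀ k → InducedMatching G k → b * k < (b ∸ a) * n) →
    irr G ^ d < 2 ^ ((d ∸ c) * n)))
-- 42 = 21 · 2, from 1/δ = `suc A` ≤ 2^(21T) and T ≤ 2/ε.
theorem4p2 = 42 , 1 , s≤s z≤n , s≤s z≤n , choose
  where
  empty-matching : ∀ {n m} (G : BipGraph n m) → InducedMatching G 0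
  empty-matching G = (λ ()) , (λ ()) , (λ { {()} }) , (λ { {()} }) , λ ()

  choose : ∀ a b → 0 < a → 0 < b →
    Σ ℕ λ c → Σ ℕ λ d → 0 < d × d ^ (1 * a) ≤ c ^ (1 * a) * 2 ^ (42 * b) ×
    (∀ n (G : BipGraph n (2 * n)) → (∀ k → InducedMatching G k → b * k < (b ∸ a) * n) →
    irr G ^ d < 2 ^ ((d ∸ c) * n))
  choose a@(suc _) b _ _ with a <? b
  -- For ε ≥ 1 even the empty matching violates the hypothesis, so δ = 1 works vacuously.
  ... | no a≮b = 1 , 1 , s≤s z≤n , ε≥1 , λ n G h →
      contradiction (subst (λ z → b * 0 < z * n) (m≤n⇒m∸n≡0 (≮⇒≥ a≮b)) (h 0 (empty-matching G))) λ ()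
    where
    ε≥1 : 1 ^ (1 * a) ≤ 1 ^ (1 * a) * 2 ^ (42 * b)
    ε≥1 = m≤m*n _ (2 ^ (42 * b)) {{m^n≢0 2 (42 * b)}}
  ... | yes a<b = 1 , suc A , s≤s z≤n , δ-large , λ n G h →
      irr-gap τ n G (n>0 n (h 0 (empty-matching G))) (λ j M → matching-small j n (h j M))
    where
    open ≤-Reasoning
    -- The integer part of 1/ε, so that 1/(τ+1) < ε.
    τ = b / a
    T = suc τ
    A = 2 ^ (20 * T)
    e = b ∸ a
    n>0 : ∀ n → b * 0 < e * n → 0 < n
    n>0 zero    h = contradiction (≤-trans h (≤-reflexive (*-zeroʳ e))) λ ()
    n>0 (suc n) _ = s≤s z≤n
    e≤τa : e ≤ τ * a
    e≤τa = m≤n+o⇒m∸n≤o b a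
      (≤-trans (≤-reflexive (m≡m%n+[m/n]*n b a)) (+-monoˡ-≤ _ (<⇒≤ (m%n<n b a))))
    matching-small : ∀ j n → b * j < e * n → T * j ≤ τ * n
    -- From b - a ≤ τa one gets 1 - ε ≤ τ/(τ+1); the factor e = b - a > 0 clears the fractions.
    matching-small j n h = *-cancelˡ-≤ e {{>-nonZero (m<n⇒0<n∸m a<b)}} (begin
      e * (T * j)             ≡⟨ r₁ e τ j ⟩
      τ * (e * j) + e * j     ≤⟨ +-monoʳ-≤ _ (*-monoˡ-≤ j e≤τa) ⟩
      τ * (e * j) + τ * a * j ≡⟨ r₂ τ e j a ⟩
      τ * ((a + e) * j)       ≡⟨ cong (λ z → τ * (z * j)) (m+[n∸m]≡n (<⇒≤ a<b)) ⟩
      τ * (b * j)             ≤⟨ *-monoʳ-≤ τ (<⇒≤ h) ⟩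
      τ * (e * n)             ≡⟨ r₃ τ e n ⟩
      e * (τ * n)             ∎)
      where
      r₁ : ∀ e τ j → e * (suc τ * j) ≡ τ * (e * j) + e * j
      r₁ = solve-∀
      r₂ : ∀ τ e j a → τ * (e * j) + τ * a * j ≡ τ * ((a + e) * j)
      r₂ = solve-∀
      r₃ : ∀ τ e n → τ * (e * n) ≡ e * (τ * n)
      r₃ = solve-∀
    suc-A≤ : suc A ≤ 2 ^ (21 * T)
    suc-A≤ = begin
      1 + A              ≤⟨ +-mono-≤ (m^n>0 2 (20 * T)) (m≤m+n A 0) ⟩
      2 ^ (1 + 20 * T)   ≤⟨ ^-monoʳ-≤ 2 (+-monoˡ-≤ (20 * T) (s≤s {n = τ} z≤n)) ⟩
      2 ^ (21 * T)       ∎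
    Ta≤2b : T * a ≤ 2 * b
    Ta≤2b = +-mono-≤ (<⇒≤ a<b) (≤-trans (m/n*n≤m b a) (m≤m+n b 0))
    δ-large : suc A ^ (1 * a) ≤ 1 ^ (1 * a) * 2 ^ (42 * b)
    δ-large = begin
      suc A ^ (1 * a)            ≡⟨ cong (suc A ^_) (*-identityˡ a) ⟩
      suc A ^ a                  ≤⟨ ^-monoˡ-≤ a suc-A≤ ⟩
      (2 ^ (21 * T)) ^ a         ≡⟨ ^-*-assoc 2 (21 * T) a ⟩
      2 ^ (21 * T * a)           ≤⟨ ^-monoʳ-≤ 2 (≤-trans (≤-reflexive (*-assoc 21 T a)) (*-monoʳ-≤ 21 Ta≤2b)) ⟩
      2 ^ (21 * (2 * b))         ≡⟨ cong (2 ^_) (*-assoc 21 2 b) ⟨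
      2 ^ (42 * b)               ≡⟨ *-identityˡ _ ⟨
      1 * 2 ^ (42 * b)           ≡⟨ cong (_* 2 ^ (42 * b)) (^-zeroˡ (1 * a)) ⟨
      1 ^ (1 * a) * 2 ^ (42 * b) ∎
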